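{- Let $G$ be a balanced Multicolored Clique instance: a $k$-partite graph with color classes $V(G)=V_1\uplus\cdots\uplus V_k$, $|V_i|=q$ for all $i$. Let $(Z,\{H_\lambda\}_{\lambda\in V(G)},k)$ be the Dual Global Label Min-Cut instance constructed from $G$ as in the context. Then $G$ contains a multicolored $k$-clique (i.e. there exist $x_i\in V_i$, $i=1,\dots,k$, such that $\{x_1,\dots,x_k\}$ is a clique) if and only if there is a set $I\subseteq V(G)$ of exactly $k$ labels such that the union graph $\bigcup_{\lambda\in I}H_\lambda$ on vertex set $Z$ is disconnected.
   Context: $\mathrm{Part}(W)$ is the set of partitions of the finite set $W$ ordered by refinement; joins $\vee$ are taken in this lattice. For a graph $H$ on vertex set $W$ (isolated vertices allowed), $\mathrm{cc}(H)$ is the partition of $W$ into connected components of $H$. A Dual Global Label Min-Cut instance consists of a vertex set $W$, graphs $H_1,\dots,H_p$ on $W$ and an integer $a\in\{0,\dots,p\}$, asking whether some $a$ of the graphs have a disconnected union. $[m]=\{1,\dots,m\}$; $k,q\ge1$. Labels: each vertex $u\in V_i$ is a label $\lambda=(i,u)$; fix a bijection of each $V_i$ with $[q]$, so that $u\in V_i$ corresponds to an index $a(u)\in[q]$. The number of labels is $p=kq$. Selection-validity partitions. Let $M_0=\max\{q,2^k\}$, let $\ell$ be a prime with $M_0<\ell<2M_0$, let $\alpha_1,\dots,\alpha_q\in\mathbb Z_\ell$ be pairwise distinct, and $X=\{\bot\}\cup(2^{[k]}\times\mathbb Z_\ell)$ with basepoint $\bot$. For $\lambda=(i,u)$ with $a=a(u)$,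 $J_\lambda$ is the graph on $X$ with exactly the edges $\bot(S,0)$ for all $S\subseteq[k]$, and $(S,t)(S\cup\{i\},t+\alpha_a)$ for all $S\subseteq[k]\setminus\{i\}$, $t\in\mathbb Z_\ell$. Put $E_\lambda=\mathrm{cc}(J_\lambda)$. Clique-consistency partitions. Let $Y=\{s,t\}\cup\{z_{uv}:u\in V_i,\ v\in V_j,\ i<j,\ uv\notin E(G)\}$ with basepoint $s$. The graphs $Q_{i,u}$ on $Y$ ($u\in V_i$) have exactly the edges given by: for each nonedge $uv$ with $u\in V_i$, $v\in V_j$, $i<j$: add $sz_{uv}$ to $Q_{i,u}$; add $z_{uv}t$ to $Q_{j,v}$; add $sz_{uv}$ to $Q_{j,w}$ for every $w\in V_j\setminus\{v\}$. Put $R_\lambda=\mathrm{cc}(Q_\lambda)$. Combination. For pointed finite sets $(X,x_0)$, $(Y,y_0)$ (here $x_0=\bot$, $y_0=s$) let $X^\circ=X\setminus\{x_0\}$, $Y^\circ=Y\setminus\{y_0\}$ and $Z=\{z_0\}\cup(X^\circ\times Y^\circ)$ with $z_0$ a new point. For $\alpha\in\mathrm{Part}(X)$ with $A_0$ the block of $x_0$, $L_X(\alpha)\in\mathrm{Part}(Z)$ has blocks $\{z_0\}\cup((A_0\setminus\{x_0\})\times Y^\circ)$ and $A\times\{y\}$ for all blocks $A\ne A_0$ of $\alpha$ and $y\in Y^\circ$; $L_Y(\beta)$ for $\beta\in\mathrm{Part}(Y)$, with $B_0$ the block of $y_0$, has blocks $\{z_0\}\cup(X^\circ\times(B_0\setminus\{y_0\}))$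 and $\{x\}\times B$ for all blocks $B\neq B_0$ of $\beta$ and $x\in X^\circ$. Define $P_\lambda=L_X(E_\lambda)\vee L_Y(R_\lambda)$, and let $H_\lambda$ be the graph on $Z$ obtained by choosing a spanning tree inside every block of $P_\lambda$ (and no other edges), so $\mathrm{cc}(H_\lambda)=P_\lambda$. The output instance is $(Z,\{H_\lambda\}_{\lambda\in V(G)},a=k)$. -}

module Defs where

open import Data.Fin using (Fin; zero; suc; toℕ; inject₁; fromℕ; _<_)
open import Data.Fin.Subset using (Subset; ⁅_⁆) renaming (_∪_ to _∪ˢ_; _∈_ to _∈ˢ_; _∉_ to _∉ˢ_)
open import Data.Fin.Subset.Properties using (x∈⁅x⁆; q⊆p∪q)
open import Data.List using (List)
open import Data.List.Membership.Propositional using (_∈_)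
open import Data.Maybe using (Maybe; just; nothing)
open import Data.Nat using (ℕ; NonZero; _+_; _*_; _^_; _⊔_) renaming (_<_ to _<ⁿ_)
open import Data.Nat.DivMod using (_mod_)
open import Data.Nat.Primality using (Prime; prime⇒nonZero)
open import Data.Product using (Σ; ∃-syntax; _×_; _,_; proj₁; proj₂)
open import Data.Sum using (inj₁; inj₂)
open import Function.Base using (_∘_)
open import Function.Bundles using (_↔_; Inverse)
open import Function.Definitions using (Injective)
open import Level using (0ℓ)
open import Relation.Binary.Construct.Closure.Equivalence as EqC using (EqClosure)
open import Relation.Binary.Construct.Closure.ReflexiveTransitive using (Star; ε; _◅◅_; return; reverse)
open import Relation.Binary.Construct.Closure.Symmetric as SymC using (SymClosure; fwd; bwd)
open import Relation.Binary.Construct.Union using (_∪_)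
open import Relation.Binary.Core using (Rel)
open import Relation.Binary.Definitions using (Decidable; Irreflexive; Symmetric)
open import Relation.Binary.Lattice.Definitions using (Supremum)
open import Relation.Binary.PropositionalEquality using (_≡_; _≢_; refl; sym; subst)
open import Relation.Binary.Structures using (IsEquivalence)
open import Relation.Nullary using (¬_)
open import Relation.Unary using (Pred)

record Graph (W : Set) : Set₁ where
  field
    Adj       : Rel W 0ℓ
    symmetric : Symmetric Adj
    loopless  : Irreflexive _≡_ Adj

open Graph public using (Adj)

fromEdges : {W : Set} (E : Rel W 0ℓ) → Irreflexive _≡_ E → Graph W
fromEdges E irr = record
  { Adj       = SymClosure E
  ; symmetric = SymC.symmetric E
  ; loopless  = λ { eq (fwd e) → irr eq e ; eq (bwd e) → irr (sym eq) e }
  }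

⋃ : {Λ W : Set} → List Λ → (Λ → Graph W) → Graph W
⋃ I H = record
  { Adj       = λ x y → ∃[ l ] l ∈ I × Adj (H l) x y
  ; symmetric = λ (l , l∈I , e) → l , l∈I , Graph.symmetric (H l) e
  ; loopless  = λ eq (l , _ , e) → Graph.loopless (H l) eq e
  }

IsClique : {W : Set} → Graph W → Pred W 0ℓ → Set
IsClique G K = ∀ {x y} → K x → K y → x ≢ y → Adj G x y

-- A cycle of length n + 3 (no repeated vertices).
record Cycle {W : Set} (_—_ : Rel W 0ℓ) : Set where
  field
    n        : ℕ
    vertex   : Fin (3 + n) → W
    distinct : Injective _≡_ _≡_ vertex
    step     : (i : Fin (2 + n)) → vertex (inject₁ i) — vertex (suc i)
    close    : vertex (fromℕ (2 + n)) — vertex zero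

-- A partition is encoded by the relation "x and y lie in the same block";
-- the block of x is the class (x ~_).
record Partition (W : Set) : Set₁ where
  infix 4 _~_
  field
    _~_           : Rel W 0ℓ
    isEquivalence : IsEquivalence _~_
  open IsEquivalence isEquivalence public

infix 4 _⟨_⟩_
_⟨_⟩_ : {W : Set} → W → Partition W → W → Set
x ⟨ P ⟩ y = Partition._~_ P x y

-- Refinement: every block of P is contained in a block of Q.
infix 4 _⊑_
_⊑_ : {W : Set} → Partition W → Partition W → Set
P ⊑ Q = ∀ {x y} → x ⟨ P ⟩ y → x ⟨ Q ⟩ y

infixr 6 _∨_
_∨_ : {W : Set} → Partition W → Partition W → Partition W
P ∨ Q = record
  { _~_           = EqClosure (Partition._~_ P ∪ Partition._~_ Q)
  ; isEquivalence = EqC.isEquivalence _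
  }

∨-supremum : {W : Set} → Supremum (_⊑_ {W}) _∨_
∨-supremum P Q =
    return ∘ fwd ∘ inj₁
  , return ∘ fwd ∘ inj₂
  , λ R P⊑R Q⊑R → EqC.fold (Partition.isEquivalence R)
      λ { (inj₁ p) → P⊑R p ; (inj₂ q) → Q⊑R q }

-- Vertices are in the same component iff a walk joins them.
cc : {W : Set} → Graph W → Partition W
cc H = record
  { _~_           = Star (Adj H)
  ; isEquivalence = record
    { refl = ε ; sym = reverse (Graph.symmetric H) ; trans = _◅◅_ }
  }

Connected : {W : Set} → Graph W → Set
Connected H = ∀ x y → x ⟨ cc H ⟩ y

Disconnected : {W : Set} → Graph W → Set
Disconnected H = ¬ Connected H

module _ {W : Set} (H : Graph W) where

  AdjWithin : Pred W 0ℓ → Rel W 0ℓ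
  AdjWithin B x y = B x × B y × Adj H x y

  -- The subgraph of H induced on the nonempty set B is a tree.
  record IsTreeOn (B : Pred W 0ℓ) : Set where
    field
      connected : ∀ {x y} → B x → B y → Star (AdjWithin B) x y
      acyclic   : ¬ Cycle (AdjWithin B)

  -- H consists of one spanning tree inside every block of P and no other edges.
  record IsSpanningForestOf (P : Partition W) : Set where
    field
      inBlocks : ∀ {x y} → Adj H x y → x ⟨ P ⟩ y
      trees    : ∀ x → IsTreeOn (Partition._~_ P x)

-- A pointed set (X , x₀) is Maybe A, where x₀ = nothing and A is X minus x₀.

Product : Set → Set → Set
Product A B = Maybe (A × B)

module _ {A B : Set} where

  -- In both relations below, `slice` is not restricted to blocks other than the
  -- base block. For the base block it only repeats pairs already related
  -- by `base`.

  module _ (α : Partition (Maybe A)) where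
    private module α = Partition α

    data BaseX : Pred (Product A B) 0ℓ where
      z₀   : BaseX nothing
      pair : ∀ {x y} → just x α.~ nothing → BaseX (just (x , y))

    data SameX : Rel (Product A B) 0ℓ where
      base  : ∀ {z z′} → BaseX z → BaseX z′ → SameX z z′
      slice : ∀ {x x′ y} → just x α.~ just x′ → SameX (just (x , y)) (just (x′ , y))

    L-X : Partition (Product A B)
    L-X = record
      { _~_ = SameX
      ; isEquivalence = record { refl = rfl _ ; sym = symm ; trans = tr }
      }
      where
      rfl : ∀ z → SameX z z
      rfl nothing  = base z₀ z₀
      rfl (just _) = slice α.refl

      symm : Symmetric SameX
      symm (base b b′) = base b′ b
      symm (slice r)   = slice (α.sym r)

      tr : ∀ {u v w} → SameX u v → SameX v w → SameX u w
      tr (base b _)        (base _ b′)  = base b b′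
      tr (base b (pair p)) (slice r)    = base b (pair (α.trans (α.sym r) p))
      tr (slice r) (base (pair p) b′)   = base (pair (α.trans r p)) b′
      tr (slice r) (slice r′)           = slice (α.trans r r′)

  module _ (β : Partition (Maybe B)) where
    private module β = Partition β

    data BaseY : Pred (Product A B) 0ℓ where
      z₀   : BaseY nothing
      pair : ∀ {x y} → just y β.~ nothing → BaseY (just (x , y))

    data SameY : Rel (Product A B) 0ℓ where
      base  : ∀ {z z′} → BaseY z → BaseY z′ → SameY z z′
      slice : ∀ {x y y′} → just y β.~ just y′ → SameY (just (x , y)) (just (x , y′))

    L-Y : Partition (Product A B)
    L-Y = record
      { _~_ = SameY
      ; isEquivalence = record { refl = rfl _ ; sym = symm ; trans = tr }
      }
      where
      rfl : ∀ z → SameY z z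
      rfl nothing  = base z₀ z₀
      rfl (just _) = slice β.refl

      symm : Symmetric SameY
      symm (base b b′) = base b′ b
      symm (slice r)   = slice (β.sym r)

      tr : ∀ {u v w} → SameY u v → SameY v w → SameY u w
      tr (base b _)        (base _ b′)  = base b b′
      tr (base b (pair p)) (slice r)    = base b (pair (β.trans (β.sym r) p))
      tr (slice r) (base (pair p) b′)   = base (pair (β.trans r p)) b′
      tr (slice r) (slice r′)           = slice (β.trans r r′)

record MulticoloredGraph (k q : ℕ) : Set₁ where
  field
    V     : Fin k → Set
    index : ∀ i → V i ↔ Fin q

  Vertex : Set
  Vertex = Σ (Fin k) V

  field
    graph   : Graph Vertex
    adj?    : Decidable (Adj graph)
    partite : ∀ {v w} → Adj graph v w → proj₁ v ≢ proj₁ w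

  idx : Vertex → Fin q
  idx (i , u) = Inverse.to (index i) u

HasMulticoloredClique : ∀ {k q} → MulticoloredGraph k q → Set
HasMulticoloredClique {k} G =
  Σ ((i : Fin k) → V i) λ x → IsClique graph (λ v → ∃[ i ] v ≡ (i , x i))
  where open MulticoloredGraph G

-- ℤ/ℓ is Fin ℓ with addition modulo ℓ.
record Parameters (k q : ℕ) : Set where
  M₀ : ℕ
  M₀ = q ⊔ 2 ^ k

  field
    ℓ           : ℕ
    ℓ-prime     : Prime ℓ
    M₀<ℓ        : M₀ <ⁿ ℓ
    ℓ<2M₀       : ℓ <ⁿ 2 * M₀
    α           : Fin q → Fin ℓ
    α-injective : Injective _≡_ _≡_ α

  instance
    ℓ-nonZero : NonZero ℓ
    ℓ-nonZero = prime⇒nonZero ℓ-prime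

  0ₗ : Fin ℓ
  0ₗ = 0 mod ℓ

  infixl 6 _+ₗ_
  _+ₗ_ : Fin ℓ → Fin ℓ → Fin ℓ
  s +ₗ t = (toℕ s + toℕ t) mod ℓ

module Construction {k q : ℕ} (G : MulticoloredGraph k q) (C : Parameters k q) where
  open MulticoloredGraph G
  open Parameters C

  Label : Set
  Label = Vertex

  X° : Set
  X° = Subset k × Fin ℓ

  -- ⊥ is nothing.
  X : Set
  X = Maybe X°

  data JEdge (l : Label) : Rel X 0ℓ where
    anchor : ∀ S → JEdge l nothing (just (S , 0ₗ))
    shift  : ∀ S t → proj₁ l ∉ˢ S →
             JEdge l (just (S , t)) (just (S ∪ˢ ⁅ proj₁ l ⁆ , t +ₗ α (idx l)))

  JEdge-irrefl : ∀ l → Irreflexive _≡_ (JEdge l)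
  JEdge-irrefl l eq (shift S t i∉S) =
    i∉S (subst (proj₁ l ∈ˢ_) (lemma eq) (q⊆p∪q S _ (x∈⁅x⁆ _)))
    where
    lemma : ∀ {S S′ : Subset k} {t t′ : Fin ℓ} → just (S , t) ≡ just (S′ , t′) → S′ ≡ S
    lemma refl = refl

  J : Label → Graph X
  J l = fromEdges (JEdge l) (JEdge-irrefl l)

  E : Label → Partition X
  E l = cc (J l)

  -- The proof fields are irrelevant, so that a nonedge uv gives a single point z u v.
  record NonEdge : Set where
    field
      {i j}    : Fin k
      u        : V i
      v        : V j
      .i<j     : i < j
      .nonAdj  : ¬ Adj graph (i , u) (j , v)

  data Y° : Set where
    t : Y°
    z : NonEdge → Y°

  -- s is nothing.
  Y : Set
  Y = Maybe Y°

  data QEdge : Label → Rel Y 0ℓ where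
    sz  : ∀ e → let open NonEdge e in QEdge (i , u) nothing (just (z e))
    zt  : ∀ e → let open NonEdge e in QEdge (j , v) (just (z e)) (just t)
    sz′ : ∀ e → let open NonEdge e in
          ∀ w → w ≢ v → QEdge (j , w) nothing (just (z e))

  QEdge-irrefl : ∀ l → Irreflexive _≡_ (QEdge l)
  QEdge-irrefl _ () (sz _)
  QEdge-irrefl _ () (zt _)
  QEdge-irrefl _ () (sz′ _ _ _)

  Q : Label → Graph Y
  Q l = fromEdges (QEdge l) (QEdge-irrefl l)

  R : Label → Partition Y
  R l = cc (Q l)

  Z : Set
  Z = Product X° Y°

  P : Label → Partition Z
  P l = L-X (E l) ∨ L-Y (R l)

{-# OPTIONS --safe #-}
module Submission where

-- A join L_X(ε) ∨ L_Y(ρ) is the top partition iff ε or ρ is: if C and D are blocks of ε and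
-- ρ avoiding the basepoints, then C × D is a union of blocks avoiding z₀.  So the union of
-- the H_λ over I is disconnected iff both the union of the J_λ and that of the Q_λ are.
-- A set I of k labels either is a transversal of the colours or repeats a colour, and in
-- the latter case the union of the J_λ is connected.  For a transversal, the union of the
-- J_λ is disconnected because ℓ > 2^k, and the union of the Q_λ joins s to t exactly when
-- two chosen vertices are nonadjacent.

open import Defs
open import Data.Bool using (Bool; true; false)
open import Data.Empty using (⊥; ⊥-elim; ⊥-elim-irr)
open import Data.Fin as Fin using (Fin; zero; suc; toℕ; punchOut; combine)
import Data.Fin.Properties as Fin
open import Data.Fin.Subset using (Subset; inside; outside; ⁅_⁆; _∪_; _∈_; _∉_; _-_) renaming (⊥ to ∅)
open import Data.Fin.Subset.Properties
  using (_∈?_; anySubset?; ⊆-antisym; ∪-identityʳ; x∈p∪q⁻; x∈p∪q⁺; x∈⁅x⁆; x∈⁅y⁆⇒x≡y; p─q⊆p; x∈p∧x≢y⇒x∈p-y)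
open import Data.List using (List; length; lookup; tabulate)
open import Data.List.Membership.Propositional using (find) renaming (_∈_ to _∈ᴸ_)
open import Data.List.Membership.Propositional.Properties using (∈-lookup; ∈-tabulate⁻)
open import Data.List.Properties using (length-tabulate)
import Data.List.Relation.Unary.All as All
open import Data.List.Relation.Unary.AllPairs using (_∷_)
open import Data.List.Relation.Unary.Any as Any using (Any)
open import Data.List.Relation.Unary.Unique.Propositional using (Unique)
import Data.List.Relation.Unary.Unique.Propositional.Properties as Unique
open import Data.Maybe as Maybe using (Maybe; just; nothing)
open import Data.Nat using (ℕ; zero; suc; pred; _+_; _*_; _^_; _≤_; NonZero; ≢-nonZero; ≢-nonZero⁻¹; >-nonZero⁻¹)
open import Data.Nat.Coprimality using (coprime-Bézout; prime⇒coprime)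
open import Data.Nat.DivMod
open import Data.Nat.GCD using (module Bézout)
open import Data.Nat.Primality using (Prime; prime⇒nonZero)
import Data.Nat.Properties as ℕ
open import Data.Nat.Tactic.RingSolver using (solve-∀)
open import Data.Product using (Σ; ∃-syntax; ∃₂; _×_; _,_; proj₁; proj₂)
open import Data.Product.Properties using (,-injectiveˡ)
open import Data.Sum using (inj₁; inj₂)
open import Data.Unit using (⊤; tt)
open import Data.Vec using ([]; _∷_; here; there)
open import Function.Base using (_∘_)
open import Function.Bundles using (_⇔_; mk⇔; Inverse; Equivalence)
open import Function.Properties.Equivalence using (⇔-isEquivalence)
open import Level using (0ℓ)
open import Relation.Binary.Construct.Closure.ReflexiveTransitive as Star using (ε; _◅_; _◅◅_; return)
import Relation.Binary.Construct.Closure.Symmetric as SymC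
open SymC using (fwd; bwd)
import Relation.Binary.Construct.On as On
open import Relation.Binary.Core using (Rel)
open import Relation.Binary.Definitions using (Irreflexive; tri<; tri≈; tri>)
open import Relation.Binary.PropositionalEquality
  using (_≡_; _≢_; refl; sym; trans; cong; cong₂; subst; module ≡-Reasoning)
open import Relation.Nullary using (¬_; Dec; yes; no; contradiction)
open import Relation.Nullary.Decidable using (map′)
open import Relation.Unary using (Pred)

-- Arithmetic modulo `n`, carried out in the natural numbers.

module _ (n : ℕ) .{{_ : NonZero n}} where

  +-congʳ-% : ∀ {a b} c → a % n ≡ b % n → (a + c) % n ≡ (b + c) % n
  +-congʳ-% {a} {b} c eq = begin
    (a + c) % n           ≡⟨ %-distribˡ-+ a c n ⟩
    (a % n + c % n) % n   ≡⟨ cong (λ r → (r + c % n) % n) eq ⟩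
    (b % n + c % n) % n   ≡⟨ %-distribˡ-+ b c n ⟨
    (b + c) % n           ∎
    where open ≡-Reasoning

  0% : 0 % n ≡ 0
  0% = m<n⇒m%n≡m (>-nonZero⁻¹ n)

  mod-cong : ∀ {a b} → a % n ≡ b % n → a mod n ≡ b mod n
  mod-cong eq = Fin.fromℕ<-cong _ _ eq _ _

  toℕ-mod : ∀ a → toℕ (a mod n) ≡ a % n
  toℕ-mod a = Fin.toℕ-fromℕ< (m%n<n a n)

  toℕ-% : (i : Fin n) → toℕ i % n ≡ toℕ i
  toℕ-% i = m<n⇒m%n≡m (Fin.toℕ<n i)

  mod-toℕ : (i : Fin n) → toℕ i mod n ≡ i
  mod-toℕ i = Fin.toℕ-injective (trans (toℕ-mod (toℕ i)) (toℕ-% i))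

-- Adding `c * m` to both sides, where `n` is `suc m`, turns the summand `c` into `c * n`, which
-- vanishes modulo `n`; this replaces subtraction.
+-cancelʳ-% : ∀ n .{{_ : NonZero n}} {a b} c → (a + c) % n ≡ (b + c) % n → a % n ≡ b % n
+-cancelʳ-% n@(suc m) {a} {b} c eq = begin
  a % n                 ≡⟨ [m+kn]%n≡m%n a c n ⟨
  (a + c * n) % n       ≡⟨ cong (_% n) (split a) ⟩
  (a + c + c * m) % n   ≡⟨ +-congʳ-% n {a + c} {b + c} (c * m) eq ⟩
  (b + c + c * m) % n   ≡⟨ cong (_% n) (split b) ⟨
  (b + c * n) % n       ≡⟨ [m+kn]%n≡m%n b c n ⟩
  b % n                 ∎
  where
  open ≡-Reasoning
  split : ∀ x → x + c * n ≡ x + c + c * m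
  split x = trans (cong (x +_) (ℕ.*-suc c m)) (sym (ℕ.+-assoc x c (c * m)))

*-congˡ-% : ∀ n .{{_ : NonZero n}} c {a b} → a % n ≡ b % n → (c * a) % n ≡ (c * b) % n
*-congˡ-% n c {a} {b} eq = begin
  (c * a) % n               ≡⟨ %-distribˡ-* c a n ⟩
  ((c % n) * (a % n)) % n   ≡⟨ cong (λ r → (c % n * r) % n) eq ⟩
  ((c % n) * (b % n)) % n   ≡⟨ %-distribˡ-* c b n ⟨
  (c * b) % n               ∎
  where open ≡-Reasoning

-- The nonzero residue of `d` is coprime to `p`, so a Bézout identity exists; over the naturals it
-- has two forms, according to which multiple is the larger.
inverse-mod-prime : ∀ {p} (p-prime : Prime p) → let instance _ = prime⇒nonZero p-prime in
                    ∀ d → d % p ≢ 0 → ∃[ x ] (x * d) % p ≡ 1 % p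
inverse-mod-prime {zero} p-prime d d≢0 =
  contradiction refl (≢-nonZero⁻¹ 0 {{prime⇒nonZero p-prime}})
inverse-mod-prime {p@(suc m)} p-prime d d≢0 =
  fromBézout (coprime-Bézout (prime⇒coprime p-prime {{≢-nonZero d≢0}} (m%n<n d p)))
  where
  open ≡-Reasoning
  fromBézout : Bézout.Identity 1 p (d % p) → ∃[ x ] (x * d) % p ≡ 1 % p
  fromBézout (Bézout.-+ x y eq) = y , (begin
    (y * d) % p         ≡⟨ *-congˡ-% p y (m%n%n≡m%n d p) ⟨
    (y * (d % p)) % p   ≡⟨ cong (_% p) eq ⟨
    (1 + x * p) % p     ≡⟨ [m+kn]%n≡m%n 1 x p ⟩
    1 % p               ∎)
  -- Here `1 + y * r ≡ x * p`, so `y * d` is -1 modulo `p`, and the factor `m`, which is `p - 1`,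
  -- corrects the sign.
  fromBézout (Bézout.+- x y eq) = m * y , (begin
    (m * y * d) % p               ≡⟨ *-congˡ-% p (m * y) (m%n%n≡m%n d p) ⟨
    (m * y * r) % p               ≡⟨ [m+kn]%n≡m%n (m * y * r) 1 p ⟨
    (m * y * r + 1 * p) % p       ≡⟨ cong (_% p) (regroup m y r) ⟩
    (1 + m * (1 + y * r)) % p     ≡⟨ cong (λ e → (1 + m * e) % p) eq ⟩
    (1 + m * (x * p)) % p         ≡⟨ cong (λ e → (1 + e) % p) (ℕ.*-assoc m x p) ⟨
    (1 + m * x * p) % p           ≡⟨ [m+kn]%n≡m%n 1 (m * x) p ⟩
    1 % p                         ∎)
    where
    r = d % p
    regroup : ∀ m y r → m * y * r + 1 * suc m ≡ 1 + m * (1 + y * r)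
    regroup = solve-∀

-- Subsets: counting them, removing an element, sums over them.

subset-code : ∀ {k} → Subset k → Fin (2 ^ k)
subset-code []      = zero
subset-code (b ∷ S) = combine (bit b) (subset-code S)
  where
  bit : Bool → Fin 2
  bit false = zero
  bit true  = suc zero

subset-code-injective : ∀ {k} {S T : Subset k} → subset-code S ≡ subset-code T → S ≡ T
subset-code-injective {S = []}        {[]}        eq = refl
subset-code-injective {S = false ∷ S} {false ∷ T} eq =
  cong (false ∷_) (subset-code-injective (Fin.combine-injectiveʳ {2} zero _ zero _ eq))
subset-code-injective {S = true ∷ S}  {true ∷ T}  eq =
  cong (true ∷_) (subset-code-injective (Fin.combine-injectiveʳ {2} (suc zero) _ (suc zero) _ eq))
subset-code-injective {S = false ∷ S} {true ∷ T}  eq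
  with () ← Fin.combine-injectiveˡ {2} zero (subset-code S) (suc zero) (subset-code T) eq
subset-code-injective {S = true ∷ S}  {false ∷ T} eq
  with () ← Fin.combine-injectiveˡ {2} (suc zero) (subset-code S) zero (subset-code T) eq

∈-remove-∪ : ∀ {k} {S : Subset k} {i} → i ∈ S → (S - i) ∪ ⁅ i ⁆ ≡ S
∈-remove-∪ {S = S} {i} i∈S = ⊆-antisym to from
  where
  to : ∀ {j} → j ∈ (S - i) ∪ ⁅ i ⁆ → j ∈ S
  to j∈ with x∈p∪q⁻ (S - i) ⁅ i ⁆ j∈
  ... | inj₁ j∈S-i = p─q⊆p S ⁅ i ⁆ j∈S-i
  ... | inj₂ j∈⁅i⁆ = subst (_∈ S) (sym (x∈⁅y⁆⇒x≡y i j∈⁅i⁆)) i∈S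
  from : ∀ {j} → j ∈ S → j ∈ (S - i) ∪ ⁅ i ⁆
  from {j} j∈S with j Fin.≟ i
  ... | yes refl = x∈p∪q⁺ (inj₂ (x∈⁅x⁆ i))
  ... | no  j≢i  = x∈p∪q⁺ (inj₁ (x∈p∧x≢y⇒x∈p-y j∈S j≢i))

∉-remove : ∀ {k} (S : Subset k) i → i ∉ S - i
∉-remove (outside ∷ S) zero    ()
∉-remove (inside  ∷ S) zero    ()
∉-remove (_       ∷ S) (suc i) (there i∈) = ∉-remove S i i∈

-- With the residues of a transversal for `a`, this is the total shift collected while growing the
-- empty set to `S`. It is reduced modulo `ℓ` only where residues are compared.
weight : ∀ {k} → (Fin k → ℕ) → Subset k → ℕ
weight a []            = 0
weight a (inside  ∷ S) = a zero + weight (a ∘ suc) S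
weight a (outside ∷ S) = weight (a ∘ suc) S

weight-insert : ∀ {k} (a : Fin k → ℕ) {S i} → i ∉ S → weight a (S ∪ ⁅ i ⁆) ≡ weight a S + a i
weight-insert a {inside  ∷ S} {zero}  i∉S = contradiction here i∉S
weight-insert a {outside ∷ S} {zero}  i∉S =
  trans (cong (λ T → a zero + weight (a ∘ suc) T) (∪-identityʳ S)) (ℕ.+-comm (a zero) _)
weight-insert a {inside  ∷ S} {suc i} i∉S =
  trans (cong (a zero +_) (weight-insert (a ∘ suc) (i∉S ∘ there))) (sym (ℕ.+-assoc (a zero) _ _))
weight-insert a {outside ∷ S} {suc i} i∉S = weight-insert (a ∘ suc) (i∉S ∘ there)

-- Pigeonhole for lists without repetition.

lookup-injective : ∀ {A : Set} {xs : List A} → Unique xs → ∀ {i j} → lookup xs i ≡ lookup xs j → i ≡ j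
lookup-injective (_  ∷ _) {zero}  {zero}  _  = refl
lookup-injective (x∉ ∷ _) {zero}  {suc j} eq = contradiction eq (All.lookup x∉ (∈-lookup j))
lookup-injective (x∉ ∷ _) {suc i} {zero}  eq = contradiction (sym eq) (All.lookup x∉ (∈-lookup i))
lookup-injective (_  ∷ u) {suc i} {suc j} eq = cong suc (lookup-injective u eq)

-- Deleting the missed value with `punchOut` leaves fewer values than positions, so two positions
-- share one; uniqueness makes the entries there distinct.
missed⇒collision : ∀ {A : Set} {n} (f : A → Fin n) {xs} → Unique xs → length xs ≡ n →
                   ∀ i → ¬ Any (λ x → f x ≡ i) xs →
                   ∃₂ λ x y → x ∈ᴸ xs × y ∈ᴸ xs × x ≢ y × f x ≡ f y
missed⇒collision {n = suc m} f {xs} unique length≡ i missed =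
  let j , j′ , j<j′ , eq = Fin.pigeonhole (ℕ.≤-reflexive (sym length≡)) (λ j → punchOut (i≢f j))
  in lookup xs j , lookup xs j′ , ∈-lookup j , ∈-lookup j′
   , Fin.<⇒≢ j<j′ ∘ lookup-injective unique
   , Fin.punchOut-injective (i≢f j) (i≢f j′) eq
  where
  i≢f : ∀ j → i ≢ f (lookup xs j)
  i≢f j eq = missed (Any.map (λ { refl → sym eq }) (∈-lookup j))

-- Partitions and connected components.

-- A partition refines this one exactly when `C` is a union of its blocks; separations are expressed
-- in this form.
Indicator : {W : Set} → Pred W 0ℓ → Partition W
Indicator C = record
  { _~_           = λ x y → C x ⇔ C y
  ; isEquivalence = On.isEquivalence C ⇔-isEquivalence
  }

cc-⊑ : ∀ {W} (H : Graph W) (P : Partition W) → (∀ {x y} → Adj H x y → x ⟨ P ⟩ y) → cc H ⊑ P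
cc-⊑ H P Adj⊑P = Star.fold (Partition._~_ P) (Partition.trans P ∘ Adj⊑P) (Partition.refl P)

fromEdges-⊑ : ∀ {W} {E : Rel W 0ℓ} (irr : Irreflexive _≡_ E) (P : Partition W) →
              (∀ {x y} → E x y → x ⟨ P ⟩ y) → cc (fromEdges E irr) ⊑ P
fromEdges-⊑ irr P E⊑P = cc-⊑ (fromEdges _ irr) P (SymC.fold (Partition.sym P) E⊑P)

cc-⋃ : ∀ {Λ W} (H : Λ → Graph W) {I l} → l ∈ᴸ I → cc (H l) ⊑ cc (⋃ I H)
cc-⋃ H l∈I = Star.map (λ e → _ , l∈I , e)

rooted⇒connected : ∀ {A} (H : Graph (Maybe A)) → (∀ a → nothing ⟨ cc H ⟩ just a) → Connected H
rooted⇒connected H root x y = sym′ (from x) ◅◅ from y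
  where
  sym′ = Partition.sym (cc H)
  from : ∀ a → nothing ⟨ cc H ⟩ a
  from nothing  = ε
  from (just a) = root a

-- Walks inside the tree of a block are walks in `H`. Together with `inBlocks` this identifies
-- `cc H` with `P`.
spanning-connected : ∀ {W} {H : Graph W} {P} → IsSpanningForestOf H P → P ⊑ cc H
spanning-connected {P = P} forest {x} x~y =
  Star.map (proj₂ ∘ proj₂) (IsTreeOn.connected (IsSpanningForestOf.trees forest x) (Partition.refl P) x~y)

-- The product partitions `L-X` and `L-Y`.

module _ {A B : Set} where

  -- If C and D are unions of blocks avoiding the basepoints, then so is C × D in L_X ∨ L_Y.
  Box : Pred (Maybe A) 0ℓ → Pred (Maybe B) 0ℓ → Pred (Product A B) 0ℓ
  Box C D nothing        = ⊥
  Box C D (just (x , y)) = C (just x) × D (just y)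

  -- The base block misses the box: the first coordinate of each of its pairs is related to the
  -- basepoint, which `C` omits. A slice keeps the second coordinate fixed.
  L-X-⊑-Box : ∀ {α C} D → ¬ C nothing → α ⊑ Indicator C → L-X α ⊑ Indicator (Box C D)
  L-X-⊑-Box {α} {C} D ¬C₀ α⊑C (base b b′) = mk⇔ (⊥-elim ∘ outside-base b) (⊥-elim ∘ outside-base b′)
    where
    outside-base : ∀ {w} → BaseX α w → ¬ Box C D w
    outside-base (pair x~₀) (c , _) = ¬C₀ (Equivalence.to (α⊑C x~₀) c)
  L-X-⊑-Box D _ α⊑C (slice x~x′) =
    mk⇔ (λ (c , d) → Equivalence.to (α⊑C x~x′) c , d) (λ (c , d) → Equivalence.from (α⊑C x~x′) c , d)

  L-Y-⊑-Box : ∀ {β} C {D} → ¬ D nothing → β ⊑ Indicator D → L-Y β ⊑ Indicator (Box C D)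
  L-Y-⊑-Box {β} C {D} ¬D₀ β⊑D (base b b′) = mk⇔ (⊥-elim ∘ outside-base b) (⊥-elim ∘ outside-base b′)
    where
    outside-base : ∀ {w} → BaseY β w → ¬ Box C D w
    outside-base (pair y~₀) (_ , d) = ¬D₀ (Equivalence.to (β⊑D y~₀) d)
  L-Y-⊑-Box C _ β⊑D (slice y~y′) =
    mk⇔ (λ (c , d) → c , Equivalence.to (β⊑D y~y′) d) (λ (c , d) → c , Equivalence.from (β⊑D y~y′) d)

  -- Embeds the first pointed set at height `y`, basepoint to basepoint, so that relations in `α`
  -- carry over to `L-X α`.
  column : B → Maybe A → Product A B
  column y = Maybe.map (_, y)

  row : A → Maybe B → Product A B
  row x = Maybe.map (x ,_)

  column-L-X : ∀ α y {a a′} → a ⟨ α ⟩ a′ → column y a ⟨ L-X α ⟩ column y a′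
  column-L-X α y {nothing} {nothing} _ = base z₀ z₀
  column-L-X α y {nothing} {just _}  r = base z₀ (pair (Partition.sym α r))
  column-L-X α y {just _}  {nothing} r = base (pair r) z₀
  column-L-X α y {just _}  {just _}  r = slice r

  row-L-Y : ∀ β x {b b′} → b ⟨ β ⟩ b′ → row x b ⟨ L-Y β ⟩ row x b′
  row-L-Y β x {nothing} {nothing} _ = base z₀ z₀
  row-L-Y β x {nothing} {just _}  r = base z₀ (pair (Partition.sym β r))
  row-L-Y β x {just _}  {nothing} r = base (pair r) z₀
  row-L-Y β x {just _}  {just _}  r = slice r

-- The graphs `J` when a colour is repeated.

module _ {k q : ℕ} (G : MulticoloredGraph k q) (C : Parameters k q) where
  open MulticoloredGraph G
  open Parameters C
  open Construction G C

  private
    αᴺ : Label → ℕ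
    αᴺ l = toℕ (α (idx l))

  idx-injective : ∀ {l l′ : Label} → proj₁ l ≡ proj₁ l′ → idx l ≡ idx l′ → l ≡ l′
  idx-injective {i , _} refl eq =
    cong (i ,_) (trans (sym (inv _)) (trans (cong (Inverse.from (index i)) eq) (inv _)))
    where inv = Inverse.strictlyInverseʳ (index i)

  _≟ⱽ_ : ∀ {i} (u v : V i) → Dec (u ≡ v)
  _≟ⱽ_ {i} u v = map′ from-idx (cong (Inverse.to (index i))) (idx (i , u) Fin.≟ idx (i , v))
    where
    from-idx : idx (i , u) ≡ idx (i , v) → u ≡ v
    from-idx eq with refl ← idx-injective {i , u} {i , v} refl eq = refl

  -- Taking the residue from a natural number lets the arithmetic of walks be done in ℕ.
  point : Subset k → ℕ → X
  point S n = just (S , n mod ℓ)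

  point-toℕ : ∀ S r → point S (toℕ r) ≡ just (S , r)
  point-toℕ S r = cong (λ r′ → just (S , r′)) (mod-toℕ ℓ r)

  point-shift : ∀ l {S} n → proj₁ l ∉ S → point S n ⟨ E l ⟩ point (S ∪ ⁅ proj₁ l ⁆) (n + αᴺ l)
  point-shift l {S} n i∉S =
    subst (λ m → point S n ⟨ E l ⟩ just (_ , m)) (mod-cong ℓ (+-congʳ-% ℓ (αᴺ l) n%ℓ))
      (return (fwd (shift S _ i∉S)))
    where
    n%ℓ : toℕ (n mod ℓ) % ℓ ≡ n % ℓ
    n%ℓ = trans (toℕ-% ℓ (n mod ℓ)) (toℕ-mod ℓ n)

  -- Two labels l, l′ of one colour i outside S give a step of length αₗ − αₗ′ ≠ 0
  -- on {S} × ℤ/ℓ via S ∪ {i}; it generates ℤ/ℓ, as ℓ is prime.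
  colour-repeated⇒J-connected : ∀ {I} {l l′ : Label} → l ∈ᴸ I → l′ ∈ᴸ I → l ≢ l′ → proj₁ l ≡ proj₁ l′ →
                                Connected (⋃ I J)
  colour-repeated⇒J-connected {I} {l@(i , u)} {l′@(.i , u′)} l∈I l′∈I l≢l′ refl = rooted⇒connected (⋃ I J) reach
    where
    open Partition (cc (⋃ I J)) using (_~_) renaming (sym to ~-sym)
    open ≡-Reasoning

    -- αₗ − αₗ′ modulo ℓ without truncated subtraction, as pred ℓ ≡ −1.
    d : ℕ
    d = αᴺ l + pred ℓ * αᴺ l′

    d+α′ : ∀ n → (n + d + αᴺ l′) % ℓ ≡ (n + αᴺ l) % ℓ
    d+α′ n = begin
      (n + d + αᴺ l′) % ℓ                     ≡⟨ cong (_% ℓ) (regroup n (αᴺ l) (pred ℓ) (αᴺ l′)) ⟩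
      (n + αᴺ l + αᴺ l′ * suc (pred ℓ)) % ℓ   ≡⟨ cong (λ m → (n + αᴺ l + αᴺ l′ * m) % ℓ) (ℕ.suc-pred ℓ) ⟩
      (n + αᴺ l + αᴺ l′ * ℓ) % ℓ              ≡⟨ [m+kn]%n≡m%n (n + αᴺ l) (αᴺ l′) ℓ ⟩
      (n + αᴺ l) % ℓ                          ∎
      where
      regroup : ∀ n a m b → n + (a + m * b) + b ≡ n + a + b * suc m
      regroup = solve-∀

    d≢0 : d % ℓ ≢ 0
    d≢0 eq = l≢l′ (idx-injective refl (α-injective (Fin.toℕ-injective (begin
      αᴺ l            ≡⟨ toℕ-% ℓ _ ⟨
      αᴺ l % ℓ        ≡⟨ d+α′ 0 ⟨
      (d + αᴺ l′) % ℓ ≡⟨ +-congʳ-% ℓ (αᴺ l′) (trans eq (sym (0% ℓ))) ⟩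
      αᴺ l′ % ℓ       ≡⟨ toℕ-% ℓ _ ⟩
      αᴺ l′           ∎))))

    step : ∀ {S} n → i ∉ S → point S n ~ point S (n + d)
    step {S} n i∉S =
      cc-⋃ J l∈I (point-shift l n i∉S) ◅◅
      ~-sym (subst (λ m → point S (n + d) ~ just (S ∪ ⁅ i ⁆ , m)) (mod-cong ℓ (d+α′ n))
                   (cc-⋃ J l′∈I (point-shift l′ (n + d) i∉S)))

    steps : ∀ {S} j → i ∉ S → point S 0 ~ point S (j * d)
    steps     zero    i∉S = ε
    steps {S} (suc j) i∉S =
      steps j i∉S ◅◅ subst (λ m → point S (j * d) ~ point S m) (ℕ.+-comm (j * d) d) (step (j * d) i∉S)

    reach-outside : ∀ {S} n → i ∉ S → nothing ~ point S n
    reach-outside {S} n i∉S =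
      -- `x` inverts the step length, so `n * x` steps lead from residue 0 to residue `n`.
      let x , xd≡1 = inverse-mod-prime ℓ-prime d d≢0
      in (_ , l∈I , fwd (anchor S)) ◅
         subst (λ m → point S 0 ~ just (S , m)) (mod-cong ℓ (begin
             (n * x * d) % ℓ    ≡⟨ cong (_% ℓ) (ℕ.*-assoc n x d) ⟩
             (n * (x * d)) % ℓ  ≡⟨ *-congˡ-% ℓ n xd≡1 ⟩
             (n * 1) % ℓ        ≡⟨ cong (_% ℓ) (ℕ.*-identityʳ n) ⟩
             n % ℓ              ∎))
           (steps (n * x) i∉S)

    reach : ∀ x → nothing ~ just x
    reach (S , r) with i ∈? S
    ... | no  i∉S = subst (nothing ~_) (point-toℕ S r) (reach-outside (toℕ r) i∉S)
    -- The last move is a shift along `l` that adds `i` to `S - i`; it starts at `n`, which is `r`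
    -- minus the residue of `l` modulo `ℓ`.
    ... | yes i∈S =
      subst (nothing ~_) (trans (cong₂ (λ T m → just (T , m)) (∈-remove-∪ i∈S) (mod-cong ℓ back)) (point-toℕ S r))
        (reach-outside n (∉-remove S i) ◅◅ cc-⋃ J l∈I (point-shift l n (∉-remove S i)))
      where
      n = toℕ r + pred ℓ * αᴺ l
      back : (n + αᴺ l) % ℓ ≡ toℕ r % ℓ
      back = begin
        (n + αᴺ l) % ℓ                       ≡⟨ cong (_% ℓ) (regroup (toℕ r) (pred ℓ) (αᴺ l)) ⟩
        (toℕ r + αᴺ l * suc (pred ℓ)) % ℓ    ≡⟨ cong (λ m → (toℕ r + αᴺ l * m) % ℓ) (ℕ.suc-pred ℓ) ⟩
        (toℕ r + αᴺ l * ℓ) % ℓ               ≡⟨ [m+kn]%n≡m%n (toℕ r) (αᴺ l) ℓ ⟩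
        toℕ r % ℓ                            ∎
        where
        regroup : ∀ r m a → r + m * a + a ≡ r + a * suc m
        regroup = solve-∀

  -- The graphs `J` and `Q` for a transversal.

  module _ (x : ∀ i → V i) where

    private
      w : Subset k → ℕ
      w = weight (λ i → αᴺ (i , x i))

    -- Otherwise every residue `c` has a subset `S` with `c + w S` divisible by `ℓ`. As `S`
    -- determines `c` by cancellation, `ℓ` residues would embed into `2 ^ k < ℓ` subsets.
    unused-residue : ∃[ c ] ∀ S → (toℕ {ℓ} c + w S) % ℓ ≢ 0
    unused-residue =
      let c , unused = Fin.¬∀⟶∃¬ ℓ Used (λ c → anySubset? (λ S → _ ℕ.≟ 0)) not-all-used
      in c , λ S eq → unused (S , eq)
      where
      Used : Fin ℓ → Set
      Used c = ∃[ S ] (toℕ c + w S) % ℓ ≡ 0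

      not-all-used : ¬ (∀ c → Used c)
      not-all-used used =
        let c , c′ , c<c′ , eq =
              Fin.pigeonhole (ℕ.≤-<-trans (ℕ.m≤n⊔m q (2 ^ k)) M₀<ℓ) (subset-code ∘ proj₁ ∘ used)
            S≡S′ = subset-code-injective {S = proj₁ (used c)} {proj₁ (used c′)} eq
            c≡c′ = +-cancelʳ-% ℓ {toℕ c} {toℕ c′} (w (proj₁ (used c)))
                     (trans (proj₂ (used c))
                       (sym (subst (λ S → (toℕ c′ + w S) % ℓ ≡ 0) (sym S≡S′) (proj₂ (used c′)))))
        in Fin.<⇒≢ c<c′ (Fin.toℕ-injective (trans (sym (toℕ-% ℓ c)) (trans c≡c′ (toℕ-% ℓ c′))))

    -- For a transversal, t − Σ_{i ∈ S} α_i is constant on the components of the union of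
    -- the J_λ away from ⊥; the block of ⊥ uses at most 2^k < ℓ of its values.
    Offset : Fin ℓ → Pred X 0ℓ
    Offset c nothing        = ⊥
    Offset c (just (S , r)) = toℕ r % ℓ ≡ (toℕ c + w S) % ℓ

    Offset-invariant : ∀ {c} → (∀ S → (toℕ c + w S) % ℓ ≢ 0) → ∀ i → E (i , x i) ⊑ Indicator (Offset c)
    Offset-invariant {c} unused i = fromEdges-⊑ (JEdge-irrefl (i , x i)) (Indicator (Offset c)) invariant
      where
      a = αᴺ (i , x i)
      invariant : ∀ {p p′} → JEdge (i , x i) p p′ → Offset c p ⇔ Offset c p′
      invariant (anchor S) = mk⇔ ⊥-elim λ eq →
        unused S (trans (sym eq) (trans (toℕ-% ℓ 0ₗ) (trans (toℕ-mod ℓ 0) (0% ℓ))))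
      invariant (shift S r i∉S) = mk⇔
        (λ eq → trans left (trans (+-congʳ-% ℓ a eq) (sym right)))
        (λ eq → +-cancelʳ-% ℓ a (trans (sym left) (trans eq right)))
        where
        left : toℕ (r +ₗ α (idx (i , x i))) % ℓ ≡ (toℕ r + a) % ℓ
        left = trans (toℕ-% ℓ (r +ₗ α (idx (i , x i)))) (toℕ-mod ℓ (toℕ r + a))
        right : (toℕ c + w (S ∪ ⁅ i ⁆)) % ℓ ≡ (toℕ c + w S + a) % ℓ
        right = cong (_% ℓ) (trans (cong (toℕ c +_) (weight-insert _ i∉S)) (sym (ℕ.+-assoc (toℕ c) (w S) a)))

    -- When `x` is a clique, this is the component of `t` in the union of the chosen `Q`: `z e`
    -- hangs on `t` if the endpoint of `e` in the later colour is chosen, and on `s` otherwise.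
    TBlock : Pred Y 0ℓ
    TBlock nothing      = ⊥
    TBlock (just t)     = ⊤
    TBlock (just (z e)) = x (NonEdge.j e) ≡ NonEdge.v e

    -- An edge `sz e` comes from the chosen earlier endpoint; were `z e` inside, both ends of the
    -- nonedge `e` would be chosen, against the clique property.
    TBlock-invariant : IsClique graph (λ v → ∃[ i ] v ≡ (i , x i)) → ∀ i → R (i , x i) ⊑ Indicator TBlock
    TBlock-invariant clique i = fromEdges-⊑ (QEdge-irrefl (i , x i)) (Indicator TBlock) (λ e → invariant e refl)
      where
      -- Generalising the label spares the match on an edge from unifying `x i` with an endpoint.
      chosen : Label → Set
      chosen (j , v) = x j ≡ v
      invariant : ∀ {l y y′} → QEdge l y y′ → chosen l → TBlock y ⇔ TBlock y′
      invariant (sz record { i<j = i<j ; nonAdj = nonAdj }) xᵢ≡u = mk⇔ ⊥-elim λ xⱼ≡v → ⊥-elim-irr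
        (nonAdj (clique (_ , cong (_ ,_) (sym xᵢ≡u)) (_ , cong (_ ,_) (sym xⱼ≡v))
                (Fin.<⇒≢ i<j ∘ ,-injectiveˡ)))
      invariant (zt e) xⱼ≡v      = mk⇔ (λ _ → tt) (λ _ → xⱼ≡v)
      invariant (sz′ e w w≢v) xⱼ≡w = mk⇔ ⊥-elim (λ xⱼ≡v → w≢v (trans (sym xⱼ≡w) xⱼ≡v))

    -- The nonedge gives a path from `s` through its `z` to `t`. Any other `z e` is joined to `t` or
    -- to `s` by the chosen vertex of its later colour.
    nonadjacent⇒Q-connected : ∀ {I} → (∀ i → (i , x i) ∈ᴸ I) →
                              ∀ {i j} → i Fin.< j → ¬ Adj graph (i , x i) (j , x j) → Connected (⋃ I Q)
    nonadjacent⇒Q-connected {I} chosen i<j ¬adj = rooted⇒connected (⋃ I Q) reach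
      where
      open Partition (cc (⋃ I Q)) using (_~_)

      uv : NonEdge
      uv = record { u = x _ ; v = x _ ; i<j = i<j ; nonAdj = ¬adj }

      s~t : nothing ~ just t
      s~t = (_ , chosen _ , fwd (sz uv)) ◅ (_ , chosen _ , fwd (zt uv)) ◅ ε

      reach : ∀ y → nothing ~ just y
      reach t     = s~t
      reach (z e) with x (NonEdge.j e) ≟ⱽ NonEdge.v e
      ... | yes xⱼ≡v = s~t ◅◅ return (_ , subst (λ v → (_ , v) ∈ᴸ I) xⱼ≡v (chosen _) , bwd (zt e))
      ... | no  xⱼ≢v = return (_ , chosen _ , fwd (sz′ e _ xⱼ≢v))

  -- The union of the spanning forests.

  module _ {H : Label → Graph Z} (forest : ∀ l → IsSpanningForestOf (H l) (P l)) where

    P⊑⋃H : ∀ {I l} → l ∈ᴸ I → P l ⊑ cc (⋃ I H)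
    P⊑⋃H l∈I = cc-⋃ H l∈I ∘ spanning-connected (forest _)

    -- Every point of `Z` lies on a column through the basepoint, and walks in the union of the `J`
    -- lift to it.
    J-connected⇒H-connected : ∀ {I} → Connected (⋃ I J) → Connected (⋃ I H)
    J-connected⇒H-connected {I} conn = rooted⇒connected (⋃ I H) λ (x , y) →
      lift y (conn nothing (just x))
      where
      lift : ∀ y {a b} → a ⟨ cc (⋃ I J) ⟩ b → column y a ⟨ cc (⋃ I H) ⟩ column y b
      -- One edge lifts to a whole walk, so the result is a walk of walks to be flattened.
      lift y = Star.concat ∘ Star.gmap (column y) λ (l , l∈I , e) →
        P⊑⋃H l∈I (proj₁ (∨-supremum (L-X (E l)) (L-Y (R l))) (column-L-X (E l) y (return e)))

    Q-connected⇒H-connected : ∀ {I} → Connected (⋃ I Q) → Connected (⋃ I H)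
    Q-connected⇒H-connected {I} conn = rooted⇒connected (⋃ I H) λ (x , y) →
      lift x (conn nothing (just y))
      where
      lift : ∀ x {a b} → a ⟨ cc (⋃ I Q) ⟩ b → row x a ⟨ cc (⋃ I H) ⟩ row x b
      lift x = Star.concat ∘ Star.gmap (row x) λ (l , l∈I , e) →
        P⊑⋃H l∈I (proj₁ (proj₂ (∨-supremum (L-X (E l)) (L-Y (R l)))) (row-L-Y (R l) x (return e)))

    -- The box of `Offset` and `TBlock` is a union of blocks of each chosen `P`; it contains
    -- `inside-box` but not the basepoint.
    clique⇒disconnected : ∀ (x : ∀ i → V i) → IsClique graph (λ v → ∃[ i ] v ≡ (i , x i)) →
                          Disconnected (⋃ (tabulate (λ i → i , x i)) H)
    clique⇒disconnected x clique conn =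
      Equivalence.from (⋃H⊑Box (conn nothing inside-box)) (Offset∋ , tt)
      where
      c = proj₁ (unused-residue x)
      unused = proj₂ (unused-residue x)
      w = weight (λ i → αᴺ (i , x i))

      inside-box : Z
      inside-box = just ((∅ , (toℕ c + w ∅) mod ℓ) , t)

      Offset∋ : Offset x c (just (∅ , (toℕ c + w ∅) mod ℓ))
      Offset∋ = trans (toℕ-% ℓ ((toℕ c + w ∅) mod ℓ)) (toℕ-mod ℓ (toℕ c + w ∅))

      box : Partition Z
      box = Indicator (Box (Offset x c) (TBlock x))

      P⊑Box : ∀ i → P (i , x i) ⊑ box
      P⊑Box i = proj₂ (proj₂ (∨-supremum (L-X (E (i , x i))) (L-Y (R (i , x i))))) box
        (L-X-⊑-Box (TBlock x) (λ ()) (Offset-invariant x unused i))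
        (L-Y-⊑-Box (Offset x c) (λ ()) (TBlock-invariant x clique i))

      ⋃H⊑Box : cc (⋃ (tabulate (λ i → i , x i)) H) ⊑ box
      ⋃H⊑Box = cc-⊑ (⋃ (tabulate (λ i → i , x i)) H) box λ (l , l∈I , e) → edge (proj₂ (∈-tabulate⁻ l∈I)) e
        where
        edge : ∀ {l i a b} → l ≡ (i , x i) → Adj (H l) a b → a ⟨ box ⟩ b
        edge {i = i} refl e = P⊑Box i (IsSpanningForestOf.inBlocks (forest (i , x i)) e)

    -- Among `k` distinct labels a missed colour forces a repeated one, which connects the union of
    -- the `J` and hence that of the `H`.
    disconnected⇒transversal : ∀ {I} → Unique I → length I ≡ k → Disconnected (⋃ I H) →
                               Σ (∀ i → V i) λ x → ∀ i → (i , x i) ∈ᴸ I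
    disconnected⇒transversal {I} unique length≡k disc
      with Fin.all? (λ i → Any.any? (λ l → proj₁ l Fin.≟ i) I)
    ... | no ¬all =
      let i , missed = Fin.¬∀⟶∃¬ k _ (λ i → Any.any? (λ l → proj₁ l Fin.≟ i) I) ¬all
          l , l′ , l∈I , l′∈I , l≢l′ , eq = missed⇒collision proj₁ unique length≡k i missed
      in contradiction (J-connected⇒H-connected (colour-repeated⇒J-connected l∈I l′∈I l≢l′ eq)) disc
    ... | yes all = (λ i → proj₁ (choose i)) , λ i → proj₂ (choose i)
      where
      choose : ∀ i → Σ (V i) λ v → (i , v) ∈ᴸ I
      choose i with find (all i)
      ... | (.i , v) , v∈I , refl = v , v∈I

    transversal-adjacent : ∀ {I} (x : ∀ i → V i) → (∀ i → (i , x i) ∈ᴸ I) → Disconnected (⋃ I H) →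
                           ∀ {i j} → i Fin.< j → Adj graph (i , x i) (j , x j)
    transversal-adjacent x chosen disc {i} {j} i<j with adj? (i , x i) (j , x j)
    ... | yes adj = adj
    ... | no ¬adj = contradiction (Q-connected⇒H-connected (nonadjacent⇒Q-connected x chosen i<j ¬adj)) disc

    transversal-clique : ∀ {I} (x : ∀ i → V i) → (∀ i → (i , x i) ∈ᴸ I) → Disconnected (⋃ I H) →
                         IsClique graph (λ v → ∃[ i ] v ≡ (i , x i))
    transversal-clique x chosen disc (i , refl) (j , refl) x≢y with Fin.<-cmp i j
    ... | tri< i<j _ _  = transversal-adjacent x chosen disc i<j
    ... | tri≈ _ refl _ = contradiction refl x≢y
    ... | tri> _ _ j<i  = Graph.symmetric graph (transversal-adjacent x chosen disc j<i)

theorem5p1 : (k q : ℕ) → 1 ≤ k → 1 ≤ q →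
    (G : MulticoloredGraph k q) (C : Parameters k q) →
    let open Construction G C in
    (H : Label → Graph Z) → (∀ l → IsSpanningForestOf (H l) (P l)) →
    HasMulticoloredClique G
    ⇔ Σ (List Label) (λ I → Unique I × length I ≡ k × Disconnected (⋃ I H))
theorem5p1 k q _ _ G C H forest = mk⇔
  (λ (x , clique) → tabulate (λ i → i , x i) , Unique.tabulate⁺ ,-injectiveˡ , length-tabulate _
                  , clique⇒disconnected G C forest x clique)
  (λ (I , unique , length≡k , disc) →
    let x , chosen = disconnected⇒transversal G C forest unique length≡k disc
    in x , transversal-clique G C forest x chosen disc)
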